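{- For every prime $N$ and every integer $m\ge2$ one has $S(m,N)\ge S^{\mathbb{Z}}(m,N)$.
   Context: Let $N$ be prime, $m\ge2$, $\mathbb{Z}_N=\mathbb{Z}/N\mathbb{Z}$ with elements identified with $0,\dots,N-1$. A hyperplane in $\mathbb{Z}_N^m$ is a set $H=\{x:h\cdot x=0\}$ for a nonzero normal $h\in\mathbb{Z}_N^m$. Let $n(H)$ be the minimum, over all normals $h$ defining $H$, of the integer $\sum_{i=1}^m h_i$ (sum of representatives in $\{0,\dots,N-1\}$). Index all hyperplanes of $\mathbb{Z}_N^m$ as $H_1,H_2,\dots$ so that $n(H_1)\le n(H_2)\le\cdots$ and put $S(m,N)=\sum_{i=1}^{N+1}n(H_i)$, the sum of the $N+1$ smallest values of $n$ (there are at least $N+1$ hyperplanes). Let $c_i(m)$ be the number of $(x_1,\dots,x_m)\in\mathbb{Z}_{\ge0}^m$ with $\sum_j x_j=i$ and $\gcd(x_1,\dots,x_m)=1$. Let $k=k^{\mathbb{Z}}_{m,N}=\min\{k\ge0:\sum_{i=1}^{k+1}c_i(m)>N+1\}$ and $$S^{\mathbb{Z}}(m,N)=\sum_{i=1}^{k}i\,c_i(m)+\Bigl(N+1-\sum_{i=1}^{k}c_i(m)\Bigr)(k+1).$$ -}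

module Defs where

open import Level using (0ℓ)
open import Data.Nat
open import Data.Nat.Properties
open import Data.Nat.Divisibility using (_∣_; _∣?_)
open import Data.Nat.GCD using (gcd; gcd-zeroˡ)
open import Data.Nat.ListAction using (sum)
open import Data.Fin.Base using (Fin; toℕ)
import Data.Fin.Properties as Fin
open import Data.List.Base as List
  using (List; []; _∷_; length; filter; take; upTo; allFin; deduplicate; cartesianProductWith)
open import Data.List.Extrema.Nat using (min)
open import Data.List.Sort ≤-decTotalOrder using (sort)
open import Data.List.Membership.Propositional using (_∈_)
open import Data.List.Membership.Propositional.Properties
  using (∈-cartesianProductWith⁺; ∈-filter⁺; ∈-upTo⁺; ∈-length)
open import Data.List.Relation.Unary.Any using (here)
open import Data.Vec.Base as Vec using (Vec; []; _∷_; zipWith; replicate; foldr′)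
open import Data.Vec.Properties using (≡-dec)
open import Data.Vec.Relation.Unary.All using (All; []; _∷_)
open import Data.Product using (∃; _×_; _,_; proj₁; proj₂)
open import Relation.Nullary using (Dec; yes; no; ¬?; contradiction)
open import Relation.Nullary.Decidable using (map′; _×-dec_; _→-dec_)
open import Relation.Unary using (Pred; Decidable; _≐_)
open import Relation.Binary.PropositionalEquality

-- All vectors of length m with entries taken from xs.
vectors : ∀ {A : Set} → List A → (m : ℕ) → List (Vec A m)
vectors xs zero    = [] ∷ []
vectors xs (suc m) = cartesianProductWith _∷_ xs (vectors xs m)

-- ℤ_N^m is Vec (Fin N) m, each residue class being given by its
-- representative in {0, …, N-1}.

reps : ∀ {m N} → Vec (Fin N) m → Vec ℕ m
reps = Vec.map toℕ

NonZeroVec : ∀ {m N} → Pred (Vec (Fin N) m) 0ℓ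
NonZeroVec {m} h = reps h ≢ replicate m 0

nonZeroVec? : ∀ {m N} → Decidable (NonZeroVec {m} {N})
nonZeroVec? {m} h = ¬? (≡-dec _≟_ (reps h) (replicate m 0))

-- The dot product of the representatives; h·x = 0 in ℤ_N means that N
-- divides it.
dot : ∀ {m N} → Vec (Fin N) m → Vec (Fin N) m → ℕ
dot h x = Vec.sum (zipWith _*_ (reps h) (reps x))

Hyperplane : ∀ {m N} → Vec (Fin N) m → Pred (Vec (Fin N) m) 0ℓ
Hyperplane {m} {N} h x = N ∣ dot h x

-- The two normals define the same set.
SameHyperplane : ∀ {m N} → Vec (Fin N) m → Vec (Fin N) m → Set
SameHyperplane h h′ = Hyperplane h ≐ Hyperplane h′

allVec? : ∀ {N} m {P : Pred (Vec (Fin N) m) 0ℓ} → Decidable P → Dec (∀ v → P v)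
allVec? zero    P? = map′ (λ { p [] → p }) (λ f → f []) (P? [])
allVec? (suc m) P? =
  map′ (λ { f (i ∷ v) → f i v }) (λ f i v → f (i ∷ v))
    (Fin.all? λ i → allVec? m λ v → P? (i ∷ v))

sameHyperplane? : ∀ {m N} (h h′ : Vec (Fin N) m) → Dec (SameHyperplane h h′)
sameHyperplane? {m} {N} h h′ = incl h h′ ×-dec incl h′ h
  where
  incl : ∀ g g′ → Dec (∀ {x} → Hyperplane g x → Hyperplane g′ x)
  incl g g′ = map′ (λ f {x} → f x) (λ f x → f {x})
    (allVec? m λ x → (N ∣? dot g x) →-dec (N ∣? dot g′ x))

normals : (m N : ℕ) → List (Vec (Fin N) m)
normals m N = filter nonZeroVec? (vectors (allFin N) m)

-- All hyperplanes, each listed once, through one of its normals.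
hyperplanes : (m N : ℕ) → List (Vec (Fin N) m)
hyperplanes m N = deduplicate sameHyperplane? (normals m N)

weight : ∀ {m N} → Vec (Fin N) m → ℕ
weight h = Vec.sum (reps h)

-- n(H) for the hyperplane H with normal h.  The first argument of min is an
-- element of the set being minimised, namely the weight of h itself.
n : ∀ {m N} → Vec (Fin N) m → ℕ
n {m} {N} h = min (weight h) (List.map weight (filter (sameHyperplane? h) (normals m N)))

S : (m N : ℕ) → ℕ
S m N = sum (take (N + 1) (sort (List.map n (hyperplanes m N))))

-- Σ₁ k f = f 1 + … + f k
Σ₁ : ℕ → (ℕ → ℕ) → ℕ
Σ₁ zero    f = 0
Σ₁ (suc k) f = Σ₁ k f + f (suc k)

gcdVec : ∀ {m} → Vec ℕ m → ℕ
gcdVec = foldr′ gcd 0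

-- Nonnegative entries with sum i are at most i, so searching
-- {0, …, i}^m finds every tuple that c i m counts.
c : (i m : ℕ) → ℕ
c i m = length (filter (λ x → (Vec.sum x ≟ i) ×-dec (gcdVec x ≟ 1)) (vectors (upTo (suc i)) m))

IsLeast : Pred ℕ 0ℓ → Pred ℕ 0ℓ
IsLeast P k = P k × (∀ j → P j → k ≤ j)

least : ∀ {P} → Decidable P → ∀ w → P w → ∃ (IsLeast P)
least P? zero    p = 0 , p , λ _ _ → z≤n
least P? (suc w) p with P? 0
... | yes p₀ = 0 , p₀ , λ _ _ → z≤n
... | no ¬p₀ with least (λ j → P? (suc j)) w p
...   | k , q , k≤ = suc k , q , λ where
          zero    p₀ → contradiction p₀ ¬p₀
          (suc j) pj → s≤s (k≤ j pj)

∈-vectors : ∀ {A : Set} {xs : List A} {m} {v : Vec A m} → All (_∈ xs) v → v ∈ vectors xs m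
∈-vectors []       = here refl
∈-vectors (p ∷ ps) = ∈-cartesianProductWith⁺ _∷_ p (∈-vectors ps)

c-positive : ∀ i {m} → 2 ≤ m → 1 ≤ c (suc i) m
c-positive i {suc (suc m)} (s≤s (s≤s _)) = ∈-length
  (∈-filter⁺ _ (∈-vectors (∈-upTo⁺ (s≤s (s≤s z≤n)) ∷ ∈-upTo⁺ (m≤n+m (suc i) 1) ∷ zeros m))
    (sum-v , gcd-zeroˡ (gcdVec (i ∷ replicate m 0))))
  where
  zeros : ∀ m → All (_∈ upTo (suc (suc i))) (replicate m 0)
  zeros zero    = []
  zeros (suc m) = ∈-upTo⁺ (s≤s z≤n) ∷ zeros m

  sum-zeros : ∀ m → Vec.sum (replicate m 0) ≡ 0
  sum-zeros zero    = refl
  sum-zeros (suc m) = sum-zeros m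

  sum-v : Vec.sum (1 ∷ i ∷ replicate m 0) ≡ suc i
  sum-v = cong suc (trans (cong (i +_) (sum-zeros m)) (+-identityʳ i))

k≤Σc : ∀ k {m} → 2 ≤ m → k ≤ Σ₁ k (λ i → c i m)
k≤Σc zero    2≤m = z≤n
k≤Σc (suc k) 2≤m =
  ≤-trans (≤-reflexive (+-comm 1 k)) (+-mono-≤ (k≤Σc k 2≤m) (c-positive k 2≤m))

Exceeds : (m N : ℕ) → Pred ℕ 0ℓ
Exceeds m N k = Σ₁ (k + 1) (λ i → c i m) > N + 1

leastExceeding : (m N : ℕ) → 2 ≤ m → ∃ (IsLeast (Exceeds m N))
leastExceeding m N 2≤m = least (λ _ → _ <? _) (N + 1)
  (≤-trans (≤-reflexive (+-comm 1 (N + 1))) (k≤Σc (N + 1 + 1) 2≤m))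

kℤ : (m N : ℕ) → 2 ≤ m → ℕ
kℤ m N 2≤m = proj₁ (leastExceeding m N 2≤m)

-- The truncated subtraction is exact: by minimality of k, the first k of the
-- c i m sum to at most N + 1.
Sℤ : (m N : ℕ) → 2 ≤ m → ℕ
Sℤ m N 2≤m = Σ₁ k (λ i → i * c i m) + (N + 1 ∸ Σ₁ k (λ i → c i m)) * (k + 1)
  where
  k : ℕ
  k = kℤ m N 2≤m

{-# OPTIONS --safe #-}

-- A minimal-weight normal of a hyperplane is primitive: its gcd is invertible
-- modulo N, so dividing by it would give a lighter normal. Hence at most c i m
-- hyperplanes have n(H) = i. Any k with c 1 m + … + c k m ≤ N + 1 then gives the
-- bound: summing x ≥ (k + 1) ∸ ((k + 1) ∸ x) over the N + 1 smallest values
-- reduces it to bounding, for each t ≤ k, the number of values that are ≤ t.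

module Submission where

open import Defs
open import Data.Nat using (ℕ; _≤_; _≥_)
open import Data.Nat.Primality using (Prime)

open import Data.Fin.Base as Fin using (Fin; toℕ; fromℕ; fromℕ<)
open import Data.Fin.Properties using (toℕ<n; toℕ-fromℕ; toℕ-fromℕ<; toℕ-injective)
open import Data.List.Base
  using (List; []; _∷_; length; filter; map; take; tabulate; allFin; upTo)
open import Data.List.Extrema.Nat using (argmin-sel; min≤xs)
open import Data.List.Membership.Propositional using (_∈_)
open import Data.List.Membership.Propositional.Properties
  using (∈-filter⁺; ∈-filter⁻; ∈-map⁺; ∈-map⁻; ∈-allFin; ∈-upTo⁺; ∈-deduplicate⁻)
open import Data.List.Properties
  using (length-take; length-map; length-removeAt′; length-tabulate;
         filter-accept; filter-reject; filter-none)
open import Data.List.Relation.Binary.Permutation.Propositional.Properties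
  using (filter-↭; ↭-length)
open import Data.List.Relation.Unary.All as All using (All; []; _∷_)
import Data.List.Relation.Unary.All.Properties as All
open import Data.List.Relation.Unary.AllPairs as AllPairs using (AllPairs; []; _∷_)
import Data.List.Relation.Unary.AllPairs.Properties as AllPairs
open import Data.List.Relation.Unary.Any as Any using (Any; here; there; _─_; index)
import Data.List.Relation.Unary.Any.Properties as Any
open import Data.List.Relation.Unary.Unique.DecSetoid.Properties using (deduplicate-!)
open import Data.Nat.Base
  using (zero; suc; _+_; _*_; _∸_; _<_; z≤n; s≤s; NonZero)
open import Data.Nat.Divisibility
open import Data.Nat.GCD using (gcd; gcd[m,n]∣m; gcd[m,n]∣n)
open import Data.Nat.ListAction using (sum)
open import Data.Nat.Primality using (euclidsLemma)
open import Data.Nat.Properties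
open import Data.List.Sort ≤-decTotalOrder using (sort; sort-↭)
open import Data.Nat.Solver using (module +-*-Solver)
open import Data.Product using (∃; _×_; _,_; proj₁; proj₂)
open import Data.Sum using (_⊎_; inj₁; inj₂)
open import Data.Vec.Base as Vec using (Vec; []; _∷_; zipWith; replicate)
open import Data.Vec.Relation.Unary.All as VecAll using ([]; _∷_)
open import Function using (_∘_; id)
open import Relation.Binary.Bundles using (DecSetoid)
open import Relation.Binary.PropositionalEquality
open import Relation.Nullary using (¬_; yes; no; contradiction)
open import Relation.Nullary.Decidable using (_×-dec_)
open import Relation.Unary using (Pred; Decidable)
open import Level using (0ℓ)

-- Counting in lists

private
  variable
    A B : Set

Any-─ : ∀ {P Q : Pred A 0ℓ} {xs} (p : Any P xs) → (∀ x → P x → ¬ Q x) →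
        Any Q xs → Any Q (xs ─ p)
Any-─ (here px) P⇒¬Q (here qx) = contradiction qx (P⇒¬Q _ px)
Any-─ (here px) P⇒¬Q (there q) = q
Any-─ (there p) P⇒¬Q (here qx) = here qx
Any-─ (there p) P⇒¬Q (there q) = there (Any-─ p P⇒¬Q q)

pigeonhole : (R : A → B → Set) → ∀ {xs} ys →
             AllPairs (λ x x′ → ∀ y → R x y → ¬ R x′ y) xs →
             All (λ x → Any (R x) ys) xs → length xs ≤ length ys
pigeonhole R ys []         []       = z≤n
pigeonhole R ys (x# ∷ xs#) (p ∷ ps) =
  ≤-trans (s≤s (pigeonhole R (ys ─ p) xs#
                  (All.zipWith (λ (x#x′ , q) → Any-─ p x#x′ q) (x# , ps))))
          (≤-reflexive (sym (length-removeAt′ ys (index p))))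

count : {P : Pred A 0ℓ} → Decidable P → List A → ℕ
count P? xs = length (filter P? xs)

count-⊎ : {P Q R : Pred A 0ℓ} (P? : Decidable P) (Q? : Decidable Q) (R? : Decidable R) →
          (∀ x → P x → Q x ⊎ R x) → ∀ xs → count P? xs ≤ count Q? xs + count R? xs
count-⊎ P? Q? R? P⇒Q⊎R []       = z≤n
count-⊎ P? Q? R? P⇒Q⊎R (x ∷ xs) with ih ← count-⊎ P? Q? R? P⇒Q⊎R xs | P? x | Q? x | R? x
... | no _  | no _  | no _  = ih
... | no _  | no _  | yes _ = ≤-trans ih (+-monoʳ-≤ (count Q? xs) (n≤1+n _))
... | no _  | yes _ | no _  = m≤n⇒m≤1+n ih
... | no _  | yes _ | yes _ = m≤n⇒m≤1+n (≤-trans ih (+-monoʳ-≤ (count Q? xs) (n≤1+n _)))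
... | yes _ | yes _ | no _  = s≤s ih
... | yes _ | yes _ | yes _ = s≤s (≤-trans ih (+-monoʳ-≤ (count Q? xs) (n≤1+n _)))
... | yes _ | no _  | yes _ = ≤-trans (s≤s ih) (≤-reflexive (sym (+-suc (count Q? xs) _)))
... | yes p | no ¬q | no ¬r with P⇒Q⊎R x p
...   | inj₁ q = contradiction q ¬q
...   | inj₂ r = contradiction r ¬r

count-take : {P : Pred A 0ℓ} (P? : Decidable P) → ∀ k xs → count P? (take k xs) ≤ count P? xs
count-take P? zero    xs       = z≤n
count-take P? (suc k) []       = z≤n
count-take P? (suc k) (x ∷ xs) with ih ← count-take P? k xs | P? x
... | yes _ = s≤s ih
... | no _  = ih

count-map : {P : Pred B 0ℓ} (P? : Decidable P) (f : A → B) →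
            ∀ xs → count P? (map f xs) ≡ count (P? ∘ f) xs
count-map P? f []       = refl
count-map P? f (x ∷ xs) with ih ← count-map P? f xs | P? (f x)
... | yes _ = cong suc ih
... | no _  = ih

deficit : ℕ → List ℕ → ℕ
deficit k xs = sum (map (k ∸_) xs)

length*k≤sum+deficit : ∀ k xs → length xs * k ≤ sum xs + deficit k xs
length*k≤sum+deficit k []       = z≤n
length*k≤sum+deficit k (x ∷ xs) = begin
  k + length xs * k                        ≤⟨ +-mono-≤ (m≤n+m∸n k x) (length*k≤sum+deficit k xs) ⟩
  (x + (k ∸ x)) + (sum xs + deficit k xs)  ≡⟨ solve 4 (λ a b c d → (a :+ b) :+ (c :+ d) := (a :+ c) :+ (b :+ d))
                                                refl x (k ∸ x) (sum xs) (deficit k xs) ⟩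
  (x + sum xs) + (k ∸ x + deficit k xs)    ∎
  where open ≤-Reasoning
        open +-*-Solver

deficit-suc : ∀ k xs → deficit (suc k) xs ≡ deficit k xs + count (_≤? k) xs
deficit-suc k []       = refl
deficit-suc k (x ∷ xs) with x ≤? k
... | yes x≤k rewrite filter-accept (_≤? k) {xs = xs} x≤k | +-∸-assoc 1 x≤k | deficit-suc k xs =
  solve 3 (λ a b c → con 1 :+ a :+ (b :+ c) := a :+ b :+ (con 1 :+ c))
    refl (k ∸ x) (deficit k xs) (count (_≤? k) xs)
  where open +-*-Solver
... | no x≰k rewrite filter-reject (_≤? k) {xs = xs} x≰k
                   | m≤n⇒m∸n≡0 (≰⇒> x≰k) | m≤n⇒m∸n≡0 (≰⇒≥ x≰k) = deficit-suc k xs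

module _ (f : ℕ → ℕ) (f0≡0 : f 0 ≡ 0) (xs : List ℕ) (count≤f : ∀ i → count (_≟ i) xs ≤ f i) where

  count-≤ : ∀ k → count (_≤? k) xs ≤ Σ₁ k f
  count-≤ zero = begin
    count (_≤? 0) xs                  ≤⟨ count-⊎ (_≤? 0) (_≟ 0) (_≟ 0) (λ _ → inj₁ ∘ n≤0⇒n≡0) xs ⟩
    count (_≟ 0) xs + count (_≟ 0) xs ≤⟨ +-mono-≤ (count≤f 0) (count≤f 0) ⟩
    f 0 + f 0                         ≡⟨ cong₂ _+_ f0≡0 f0≡0 ⟩
    0                                 ∎
    where open ≤-Reasoning
  count-≤ (suc k) = ≤-trans
    (count-⊎ (_≤? suc k) (_≤? k) (_≟ suc k) (λ _ → split) xs)
    (+-mono-≤ (count-≤ k) (count≤f (suc k)))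
    where
    split : ∀ {x} → x ≤ suc k → x ≤ k ⊎ x ≡ suc k
    split x≤1+k with m≤n⇒m<n∨m≡n x≤1+k
    ... | inj₁ (s≤s x≤k) = inj₁ x≤k
    ... | inj₂ x≡1+k     = inj₂ x≡1+k

  deficit-≤ : ∀ k → deficit (suc k) xs + Σ₁ k (λ i → i * f i) ≤ Σ₁ k f * suc k
  deficit-≤ zero = begin
    deficit 1 xs + 0                ≡⟨ +-identityʳ _ ⟩
    deficit 1 xs                    ≡⟨ deficit-suc 0 xs ⟩
    deficit 0 xs + count (_≤? 0) xs ≤⟨ +-mono-≤ (≤-reflexive (deficit-0 xs)) (count-≤ 0) ⟩
    0                               ∎
    where
    open ≤-Reasoning
    deficit-0 : ∀ xs → deficit 0 xs ≡ 0
    deficit-0 []       = refl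
    deficit-0 (x ∷ xs) = cong₂ _+_ (0∸n≡0 x) (deficit-0 xs)
  deficit-≤ (suc k) = begin
    deficit (2 + k) xs + (b + suc k * g)
      ≡⟨ cong (_+ (b + suc k * g)) (deficit-suc (suc k) xs) ⟩
    d + count (_≤? suc k) xs + (b + suc k * g)
      ≤⟨ +-monoˡ-≤ _ (+-monoʳ-≤ d (count-≤ (suc k))) ⟩
    d + (a + g) + (b + suc k * g)
      ≡⟨ solve 5 (λ d a g b l → d :+ (a :+ g) :+ (b :+ l :* g) := (d :+ b) :+ (a :+ g :+ l :* g))
           refl d a g b (suc k) ⟩
    (d + b) + (a + g + suc k * g)
      ≤⟨ +-monoˡ-≤ _ (deficit-≤ k) ⟩
    a * suc k + (a + g + suc k * g)
      ≡⟨ solve 3 (λ a l g → a :* l :+ (a :+ g :+ l :* g) := (a :+ g) :* (con 1 :+ l))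
           refl a (suc k) g ⟩
    (a + g) * suc (suc k) ∎
    where
    open ≤-Reasoning
    open +-*-Solver
    a = Σ₁ k f
    b = Σ₁ k (λ i → i * f i)
    d = deficit (suc k) xs
    g = f (suc k)

  sum-≥ : ∀ k → Σ₁ k f ≤ length xs →
          Σ₁ k (λ i → i * f i) + (length xs ∸ Σ₁ k f) * suc k ≤ sum xs
  sum-≥ k a≤l = begin
    b + (l ∸ a) * suc k          ≡⟨ cong (b +_) (*-distribʳ-∸ (suc k) l a) ⟩
    b + (l * suc k ∸ a * suc k)  ≡⟨ +-∸-assoc b (*-monoˡ-≤ (suc k) a≤l) ⟨
    (b + l * suc k) ∸ a * suc k  ≤⟨ m≤n+o⇒m∸n≤o _ (a * suc k) bound ⟩
    sum xs                       ∎
    where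
    open ≤-Reasoning
    open +-*-Solver
    a = Σ₁ k f
    b = Σ₁ k (λ i → i * f i)
    d = deficit (suc k) xs
    l = length xs
    bound : b + l * suc k ≤ a * suc k + sum xs
    bound = begin
      b + l * suc k       ≤⟨ +-monoʳ-≤ b (length*k≤sum+deficit (suc k) xs) ⟩
      b + (sum xs + d)    ≡⟨ solve 3 (λ b s d → b :+ (s :+ d) := (d :+ b) :+ s) refl b (sum xs) d ⟩
      (d + b) + sum xs    ≤⟨ +-monoˡ-≤ (sum xs) (deficit-≤ k) ⟩
      a * suc k + sum xs  ∎

-- Vectors of natural numbers

sum≡0⇒zeros : ∀ {m} (v : Vec ℕ m) → Vec.sum v ≡ 0 → v ≡ replicate m 0
sum≡0⇒zeros []      _  = refl
sum≡0⇒zeros (x ∷ v) eq = cong₂ _∷_ (m+n≡0⇒m≡0 x eq) (sum≡0⇒zeros v (m+n≡0⇒n≡0 x eq))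

gcdVec-zeros : ∀ m → gcdVec (replicate m 0) ≡ 0
gcdVec-zeros zero    = refl
gcdVec-zeros (suc m) = cong (gcd 0) (gcdVec-zeros m)

sum-scale : ∀ {m} d (v : Vec ℕ m) → Vec.sum (Vec.map (d *_) v) ≡ d * Vec.sum v
sum-scale d []      = sym (*-zeroʳ d)
sum-scale d (x ∷ v) = trans (cong (d * x +_) (sum-scale d v)) (sym (*-distribˡ-+ d x (Vec.sum v)))

zipWith-scale : ∀ {m} d (u v : Vec ℕ m) →
                zipWith _*_ (Vec.map (d *_) u) v ≡ Vec.map (d *_) (zipWith _*_ u v)
zipWith-scale d []      []      = refl
zipWith-scale d (x ∷ u) (y ∷ v) = cong₂ _∷_ (*-assoc d x y) (zipWith-scale d u v)

sum≤i⇒All<1+i : ∀ {m i} (v : Vec ℕ m) → Vec.sum v ≤ i → VecAll.All (_∈ upTo (suc i)) v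
sum≤i⇒All<1+i []      _ = []
sum≤i⇒All<1+i (x ∷ v) s =
  ∈-upTo⁺ (s≤s (m+n≤o⇒m≤o x s)) ∷ sum≤i⇒All<1+i v (m+n≤o⇒n≤o x s)

c₀≡0 : ∀ m → c 0 m ≡ 0
c₀≡0 m = cong length (filter-none _ {xs = vectors (upTo 1) m} (All.tabulate λ {v} _ → ¬primitive v))
  where
  ¬primitive : ∀ v → ¬ (Vec.sum v ≡ 0 × gcdVec v ≡ 1)
  ¬primitive v (sum≡0 , gcd≡1) =
    contradiction (trans (sym gcd≡1) (trans (cong gcdVec (sum≡0⇒zeros v sum≡0)) (gcdVec-zeros m))) λ ()

∣⇒<⇒≡0 : ∀ {d x} → d ∣ x → x < d → x ≡ 0
∣⇒<⇒≡0 {x = zero}  _   _   = refl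
∣⇒<⇒≡0 {x = suc _} d∣x x<d = contradiction d∣x (>⇒∤ x<d)

∣gcdVec⇒zeros : ∀ {m N} (h : Vec (Fin N) m) → N ∣ gcdVec (reps h) → reps h ≡ replicate m 0
∣gcdVec⇒zeros []      _   = refl
∣gcdVec⇒zeros (i ∷ h) N∣g = cong₂ _∷_
  (∣⇒<⇒≡0 (∣-trans N∣g (gcd[m,n]∣m (toℕ i) _)) (toℕ<n i))
  (∣gcdVec⇒zeros h (∣-trans N∣g (gcd[m,n]∣n (toℕ i) _)))

divide : ∀ {m N} d .{{_ : NonZero d}} (h : Vec (Fin N) m) → d ∣ gcdVec (reps h) →
         ∃ λ (g : Vec (Fin N) m) → reps h ≡ Vec.map (d *_) (reps g)
divide d []      _   = [] , refl
divide d (i ∷ h) d∣g with ∣-trans d∣g (gcd[m,n]∣m (toℕ i) _)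
                        | divide d h (∣-trans d∣g (gcd[m,n]∣n (toℕ i) _))
... | divides q i≡q*d | g , eq = fromℕ< q<N ∷ g , cong₂ _∷_
  (trans i≡q*d (trans (*-comm q d) (cong (d *_) (sym (toℕ-fromℕ< q<N))))) eq
  where
  q<N = ≤-<-trans (≤-trans (m≤m*n q d) (≤-reflexive (sym i≡q*d))) (toℕ<n i)

-- Hyperplanes and their normals

module _ {m N : ℕ} where

  Same : Vec (Fin N) m → Vec (Fin N) m → Set
  Same = SameHyperplane

  Same-sym : ∀ g h → Same g h → Same h g
  Same-sym _ _ (g⊆h , h⊆g) = h⊆g , g⊆h

  Same-trans : ∀ f g h → Same f g → Same g h → Same f h
  Same-trans _ _ _ (f⊆g , g⊆f) (g⊆h , h⊆g) = (λ p → g⊆h (f⊆g p)) , λ p → g⊆f (h⊆g p)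

  reps-Same : ∀ (g h : Vec (Fin N) m) → reps g ≡ reps h → Same g h
  reps-Same g h eq =
    (λ {x} → subst (λ r → N ∣ Vec.sum (zipWith _*_ r (reps x))) eq) ,
    (λ {x} → subst (λ r → N ∣ Vec.sum (zipWith _*_ r (reps x))) (sym eq))

  ∈-normals : ∀ {h : Vec (Fin N) m} → NonZeroVec h → h ∈ normals m N
  ∈-normals {h} h≢0 = ∈-filter⁺ nonZeroVec? (∈-vectors (entries h)) h≢0
    where
    entries : ∀ {k} (v : Vec (Fin N) k) → VecAll.All (_∈ allFin N) v
    entries []      = []
    entries (i ∷ v) = ∈-allFin i ∷ entries v

  n≤weight : ∀ (h g : Vec (Fin N) m) → NonZeroVec g → Same h g → n h ≤ weight g
  n≤weight h g g≢0 h~g = All.lookup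
    (min≤xs (weight h) (map weight (filter (sameHyperplane? h) (normals m N))))
    (∈-map⁺ weight (∈-filter⁺ (sameHyperplane? h) (∈-normals g≢0) h~g))

  minimal-normal : ∀ (h : Vec (Fin N) m) → NonZeroVec h →
                   ∃ λ g → Same h g × NonZeroVec g × weight g ≡ n h
  minimal-normal h h≢0
    with argmin-sel id (weight h) (map weight (filter (sameHyperplane? h) (normals m N)))
  ... | inj₁ n≡w = h , (id , id) , h≢0 , sym n≡w
  ... | inj₂ n∈  with ∈-map⁻ weight n∈
  ...   | g , g∈ , n≡w with ∈-filter⁻ (sameHyperplane? h) {xs = normals m N} g∈
  ...     | g∈normals , h~g =
    g , h~g , proj₂ (∈-filter⁻ nonZeroVec? {xs = vectors (allFin N) m} g∈normals) , sym n≡w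

  Same-decSetoid : DecSetoid 0ℓ 0ℓ
  Same-decSetoid = record
    { Carrier = Vec (Fin N) m
    ; _≈_ = Same
    ; isDecEquivalence = record
      { isEquivalence = record
        { refl = id , id
        ; sym = λ {g} {h} → Same-sym g h
        ; trans = λ {f} {g} {h} → Same-trans f g h
        }
      ; _≟_ = sameHyperplane?
      }
    }

  hyperplanes-≁ : AllPairs (λ g h → ¬ Same g h) (hyperplanes m N)
  hyperplanes-≁ = deduplicate-! Same-decSetoid (normals m N)

  module _ (N-prime : Prime N) where

    scale-Same : ∀ d (h g : Vec (Fin N) m) → ¬ N ∣ d →
                 reps h ≡ Vec.map (d *_) (reps g) → Same h g
    scale-Same d h g N∤d h≡dg = to , from
      where
      dot≡ : ∀ x → dot h x ≡ d * dot g x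
      dot≡ x = trans (cong (λ r → Vec.sum (zipWith _*_ r (reps x))) h≡dg)
        (trans (cong Vec.sum (zipWith-scale d (reps g) (reps x)))
               (sum-scale d (zipWith _*_ (reps g) (reps x))))
      to : ∀ {x} → Hyperplane h x → Hyperplane g x
      to {x} p with euclidsLemma d (dot g x) N-prime (subst (N ∣_) (dot≡ x) p)
      ... | inj₁ N∣d = contradiction N∣d N∤d
      ... | inj₂ q   = q
      from : ∀ {x} → Hyperplane g x → Hyperplane h x
      from {x} p = subst (N ∣_) (sym (dot≡ x)) (∣n⇒∣m*n d p)

    minimal⇒primitive : ∀ (h : Vec (Fin N) m) → NonZeroVec h →
                        (∀ g → NonZeroVec g → Same h g → weight h ≤ weight g) → gcdVec (reps h) ≡ 1
    minimal⇒primitive h h≢0 minimal with gcdVec (reps h) in eq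
    ... | 0 = contradiction (∣gcdVec⇒zeros h (subst (N ∣_) (sym eq) (N ∣0))) h≢0
    ... | 1 = refl
    ... | d@(suc (suc e)) with divide d h (∣-reflexive (sym eq))
    ...   | g , h≡dg = contradiction (sum≡0⇒zeros (reps h) weight-h≡0) h≢0
      where
      N∤d : ¬ N ∣ d
      N∤d N∣d = h≢0 (∣gcdVec⇒zeros h (subst (N ∣_) (sym eq) N∣d))
      weight-h : weight h ≡ d * weight g
      weight-h = trans (cong Vec.sum h≡dg) (sum-scale d (reps g))
      vanishes : weight g ≡ 0 → weight h ≡ 0
      vanishes eq₀ = trans weight-h (trans (cong (d *_) eq₀) (*-zeroʳ d))
      g≢0 : NonZeroVec g
      g≢0 g≡0 = h≢0 (sum≡0⇒zeros (reps h) (vanishes (trans (cong Vec.sum g≡0) (sum-zeros m))))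
        where
        sum-zeros : ∀ k → Vec.sum (replicate k 0) ≡ 0
        sum-zeros zero    = refl
        sum-zeros (suc k) = sum-zeros k
      weight-g≡0 : weight g ≡ 0
      weight-g≡0 = m+n≡0⇒m≡0 (weight g) {e * weight g} (n≤0⇒n≡0 (+-cancelˡ-≤ (weight g) _ 0
        (≤-trans (≤-reflexive (sym weight-h))
          (≤-trans (minimal g g≢0 (scale-Same d h g N∤d h≡dg)) (≤-reflexive (sym (+-identityʳ _)))))))
      weight-h≡0 : weight h ≡ 0
      weight-h≡0 = vanishes weight-g≡0

    count-n≤c : ∀ i → count (_≟ i) (map n (hyperplanes m N)) ≤ c i m
    count-n≤c i = ≤-trans (≤-reflexive (count-map (_≟ i) n (hyperplanes m N)))
      (pigeonhole R _
        (AllPairs.filter⁺ _ (AllPairs.map (λ {g} {h} g≁h v (f , g~f , f≡v) (f′ , h~f′ , f′≡v) →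
            g≁h (Same-trans g f h g~f
              (Same-trans f f′ h (reps-Same f f′ (trans f≡v (sym f′≡v))) (Same-sym h f′ h~f′))))
          hyperplanes-≁))
        (All.tabulate λ {h} → covered h))
      where
      R : Vec (Fin N) m → Vec ℕ m → Set
      R h v = ∃ λ g → Same h g × reps g ≡ v
      covered : ∀ h → h ∈ filter (λ h → n h ≟ i) (hyperplanes m N) →
                Any (R h) (filter (λ x → (Vec.sum x ≟ i) ×-dec (gcdVec x ≟ 1)) (vectors (upTo (suc i)) m))
      covered h h∈ with ∈-filter⁻ (λ h → n h ≟ i) {xs = hyperplanes m N} h∈
      ... | h∈hs , n≡i with minimal-normal h
            (proj₂ (∈-filter⁻ nonZeroVec? {xs = vectors (allFin N) m}
              (∈-deduplicate⁻ sameHyperplane? (normals m N) h∈hs)))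
      ...   | g , h~g , g≢0 , w≡n = Any.map (λ v≡ → g , h~g , v≡)
        (∈-filter⁺ _ (∈-vectors (sum≤i⇒All<1+i (reps g) (≤-reflexive w≡i)))
          (w≡i , minimal⇒primitive g g≢0 λ f f≢0 g~f →
            ≤-trans (≤-reflexive w≡n) (n≤weight h f f≢0 (Same-trans h g f h~g g~f))))
        where
        w≡i : weight g ≡ i
        w≡i = trans w≡n n≡i

dot-zeros : ∀ {N} m → dot (replicate m (Fin.zero {N})) (replicate m Fin.zero) ≡ 0
dot-zeros zero    = refl
dot-zeros (suc m) = dot-zeros m

∣-shift-cancel : ∀ {N a b} y → N ∣ y + a → N ∣ y + b → a ≤ b → b < N → a ≡ b
∣-shift-cancel {N} {a} {b} y N∣y+a N∣y+b a≤b b<N = ≤-antisym a≤b (m∸n≡0⇒m≤n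
  (∣⇒<⇒≡0 (∣m+n∣m⇒∣n (subst (N ∣_) split N∣y+b) N∣y+a) (≤-<-trans (m∸n≤m b a) b<N)))
  where
  split : y + b ≡ (y + a) + (b ∸ a)
  split = trans (cong (y +_) (sym (m+[n∸m]≡n a≤b))) (sym (+-assoc y a (b ∸ a)))

-- The normals (0,1,0,…) and (1,a,0,…) already define N + 1 distinct hyperplanes.
hyperplanes-length : ∀ m N → 2 ≤ m → 2 ≤ N → N + 1 ≤ length (hyperplanes m N)
hyperplanes-length (suc (suc m)) N@(suc N-1@(suc _)) (s≤s (s≤s _)) (s≤s (s≤s _)) = ≤-trans
  (≤-reflexive (trans (+-comm N 1) (cong suc (sym (length-tabulate line)))))
  (pigeonhole Same {axis ∷ tabulate line} (hyperplanes (2 + m) N)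
    (AllPairs.map {R = λ g h → ¬ Same g h}
      (λ {g} {h} g≁h f g~f h~f → g≁h (Same-trans g f h g~f (Same-sym h f h~f)))
      (All.tabulate⁺ {f = line} axis≁line ∷
       AllPairs.tabulate⁺ {f = line} λ {a} {b} a≢b p → a≢b (line-injective a b p)))
    (covered axis (λ ()) ∷ All.tabulate⁺ {f = line} λ a → covered (line a) λ ()))
  where
  0s : Vec (Fin N) m
  0s = replicate m Fin.zero

  axis : Vec (Fin N) (2 + m)
  axis = Fin.zero ∷ Fin.suc Fin.zero ∷ 0s

  line : Fin N → Vec (Fin N) (2 + m)
  line a = Fin.suc Fin.zero ∷ a ∷ 0s

  covered : ∀ h → NonZeroVec h → Any (Same h) (hyperplanes (2 + m) N)
  covered h h≢0 = Any.deduplicate⁺ sameHyperplane? (λ {f} {g} g~f h~f → Same-trans h f g h~f (Same-sym g f g~f))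
    (Any.map (λ {g} h≡g → reps-Same h g (cong reps h≡g)) (∈-normals h≢0))

  axis≁line : ∀ a → ¬ Same axis (line a)
  axis≁line a (axis⊆line , _) = contradiction
    (subst (N ∣_) dot-line (axis⊆line {x} (subst (N ∣_) (sym (dot-zeros {N-1} m)) (N ∣0))))
    (>⇒∤ (s≤s (s≤s z≤n)))
    where
    x = Fin.suc Fin.zero ∷ Fin.zero ∷ 0s
    dot-line : dot (line a) x ≡ 1
    dot-line = cong suc (cong₂ _+_ (*-zeroʳ (toℕ a)) (dot-zeros {N-1} m))

  -- N − 1 represents −1, so (1,a,0,…) and (a,−1,0,…) are orthogonal.
  point : Fin N → Vec (Fin N) (2 + m)
  point a = a ∷ fromℕ N-1 ∷ 0s

  dot-line-point : ∀ a b → dot (line b) (point a) ≡ toℕ b * N-1 + toℕ a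
  dot-line-point a b = trans
    (cong₂ _+_ (+-identityʳ (toℕ a))
      (trans (cong₂ _+_ (cong (toℕ b *_) (toℕ-fromℕ N-1)) (dot-zeros {N-1} m)) (+-identityʳ _)))
    (+-comm (toℕ a) _)

  N∣b*N-1+b : ∀ b → N ∣ b * N-1 + b
  N∣b*N-1+b b = divides b (trans (+-comm (b * N-1) b) (sym (*-suc b N-1)))

  line-injective : ∀ a b → Same (line a) (line b) → a ≡ b
  line-injective a b (a⊆b , _) with ≤-total (toℕ a) (toℕ b)
                                   | subst (N ∣_) (dot-line-point a b) (a⊆b {point a}
                                       (subst (N ∣_) (sym (dot-line-point a a)) (N∣b*N-1+b (toℕ a))))
  ... | inj₁ a≤b | N∣b*N-1+a =
    toℕ-injective (∣-shift-cancel _ N∣b*N-1+a (N∣b*N-1+b (toℕ b)) a≤b (toℕ<n b))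
  ... | inj₂ b≤a | N∣b*N-1+a =
    toℕ-injective (sym (∣-shift-cancel _ (N∣b*N-1+b (toℕ b)) N∣b*N-1+a b≤a (toℕ<n a)))

prime⇒2≤ : ∀ {p} → Prime p → 2 ≤ p
prime⇒2≤ {suc (suc _)} _ = s≤s (s≤s z≤n)

Σc≤N+1 : ∀ m N 2≤m → Σ₁ (kℤ m N 2≤m) (λ i → c i m) ≤ N + 1
Σc≤N+1 m N 2≤m with leastExceeding m N 2≤m
... | zero  , _         = z≤n
... | suc j , _ , least = ≮⇒≥ λ exceeds → 1+n≰n
  (least j (subst (λ k → N + 1 < Σ₁ k (λ i → c i m)) (+-comm 1 j) exceeds))

lemma2p19 : ∀ (m N : ℕ) → Prime N → (2≤m : 2 ≤ m) → S m N ≥ Sℤ m N 2≤m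
lemma2p19 m N N-prime 2≤m = begin
  b + (N + 1 ∸ a) * (k + 1)      ≡⟨ cong₂ (λ l k+1 → b + (l ∸ a) * k+1) (sym length≡) (+-comm k 1) ⟩
  b + (length xs ∸ a) * suc k    ≤⟨ sum-≥ (λ i → c i m) (c₀≡0 m) xs count≤c k
                                      (≤-trans (Σc≤N+1 m N 2≤m) (≤-reflexive (sym length≡))) ⟩
  sum xs                         ∎
  where
  open ≤-Reasoning
  k  = kℤ m N 2≤m
  a  = Σ₁ k (λ i → c i m)
  b  = Σ₁ k (λ i → i * c i m)
  ns = map n (hyperplanes m N)
  xs = take (N + 1) (sort ns)

  length≡ : length xs ≡ N + 1
  length≡ = trans (length-take (N + 1) (sort ns)) (m≤n⇒m⊓n≡m (≤-trans
    (hyperplanes-length m N 2≤m (prime⇒2≤ N-prime))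
    (≤-reflexive (sym (trans (↭-length (sort-↭ ns)) (length-map n (hyperplanes m N)))))))

  count≤c : ∀ i → count (_≟ i) xs ≤ c i m
  count≤c i = ≤-trans (count-take (_≟ i) (N + 1) (sort ns))
    (≤-trans (≤-reflexive (↭-length (filter-↭ (_≟ i) (sort-↭ ns)))) (count-n≤c {m} N-prime i))
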